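{- Let $G$ be a connected graph with vertex set $\{u_1,\dots,u_n\}$, $n\ge2$, and let $\mathcal{H}=\{H_1,\dots,H_n\}$ be a family of non-empty graphs. Then $\dim_l(G\circ\mathcal{H})=n$ if and only if each true twin equivalence class of $G$ contains at most one vertex $u_i$ with $H_i\in\mathcal{G}$, and each $H_i$ is a bipartite graph having exactly one non-trivial connected component $H_i^*$, and this component has radius $r(H_i^*)\le2$.
   Context: All graphs are finite and simple with at least one vertex; non-empty means having at least one edge; a non-trivial connected component is one with at least two vertices. $d_G$ is shortest-path distance ($+\infty$ between components), $d_{G,2}=\min\{d_G,2\}$; $s$ distinguishes $x,y$ w.r.t. $d$ if $d(s,x)\ne d(s,y)$. $\dim_l(G)$: minimum size of $S\subseteq V(G)$ such that any two adjacent vertices are distinguished w.r.t. $d_G$ by some vertex of $S$. Local adjacency bases of $H$: minimum-size sets $S\subseteq V(H)$ such that any two adjacent vertices are distinguished w.r.t. $d_{H,2}$ by some vertex of $S$. $\mathcal{G}$: class of graphs $H$ such that every local adjacency basis $B$ of $H$ satisfies $B\subseteq N_H(v)$ for some $v\in V(H)$. True twins: $N[x]=N[y]$. Lexicographic product $G\circ\mathcal{H}$: vertex set $\bigcup_i\{u_i\}\times V(H_i)$, $(u_i,v)\sim(u_j,w)$ iff $u_iu_j\in E(G)$, or $i=j$ and $vw\in E(H_i)$. -}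

module Defs where

open import Level using (0ℓ)
open import Data.Nat.Base using (ℕ; zero; suc; _+_; _≤_; _<_; z≤n; s≤s)
import Data.Nat.Properties as ℕ
open import Data.Nat.Induction using (<-rec)
open import Data.Fin.Base as Fin using (Fin; zero; suc; toℕ)
import Data.Fin.Properties as Fin
open import Data.Fin.Subset using (Subset; _∈_; ∣_∣; ⊤; inside; outside)
open import Data.Fin.Subset.Properties using (anySubset?; _∈?_; ∈⊤)
open import Data.Vec.Base using ([]; _∷_; here; there)
open import Data.Vec.Functional as Vector using (Vector)
open import Data.List.Base using (List; map; allFin)
import Data.List.Extrema as Extrema
open import Data.Bool.Base using (Bool)
open import Data.Product
  using (Σ; ∃; ∃-syntax; ∃!; _×_; _,_; proj₁; proj₂)
open import Data.Product.Function.Dependent.Propositional using (Σ-↔)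
open import Data.Sum.Base using (_⊎_; inj₁; inj₂)
open import Data.Sum.Function.Propositional using (_⊎-↔_)
open import Function.Base using (_∘_; case_of_)
open import Function.Bundles using (_↔_; _⇔_; Inverse; mk↔ₛ′)
open import Function.Properties.Inverse
  using (↔-refl; ↔-sym; ↔-trans; ↔⇒↣)
import Algebra.Construct.NaturalChoice.Min as Min
open import Relation.Binary.Bundles using (TotalOrder)
open import Relation.Binary.Core using (Rel)
open import Relation.Binary.Definitions using (Decidable; DecidableEquality)
import Relation.Binary.Construct.Add.Supremum.NonStrict as AddSupremum
open import Relation.Binary.PropositionalEquality
  using (_≡_; _≢_; refl; sym; trans; cong; subst)
open import Relation.Nullary.Construct.Add.Supremum using (_⁺; [_]; ⊤⁺)
open import Relation.Nullary.Decidable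
  using (Dec; yes; no; map′; _×-dec_; _→-dec_; ¬?; via-injection)
open import Relation.Nullary.Negation using (¬_; contradiction)
open import Relation.Unary as Pred using (Pred)

------------------------------------------------------------------------
-- Extended natural numbers

ℕ∞ : Set
ℕ∞ = ℕ ⁺

pattern ∞ = ⊤⁺

≤∞-totalOrder : TotalOrder 0ℓ 0ℓ 0ℓ
≤∞-totalOrder = record
  { isTotalOrder = AddSupremum.≤⁺-isTotalOrder-≡ _≤_ ℕ.≤-isTotalOrder }

open TotalOrder ≤∞-totalOrder public using () renaming (_≤_ to _≤∞_)
open Min ≤∞-totalOrder public using () renaming (_⊓_ to _⊓∞_)
open Extrema ≤∞-totalOrder public using () renaming (min to min∞; max to max∞)

_≟∞_ : DecidableEquality ℕ∞
[ m ] ≟∞ [ n ] = map′ (cong [_]) (λ { refl → refl }) (m ℕ.≟ n)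
[ m ] ≟∞ ∞     = no λ ()
∞     ≟∞ [ n ] = no λ ()
∞     ≟∞ ∞     = yes refl

------------------------------------------------------------------------
-- Minima

Least : Pred ℕ 0ℓ → Pred ℕ 0ℓ
Least P m = P m × (∀ k → P k → m ≤ k)

least : ∀ {P} → Pred.Decidable P → ∀ n → P n → ∃ (Least P)
least P? zero    p = zero , p , λ _ _ → z≤n
least {P} P? (suc n) p with P? zero
... | yes p₀ = zero , p₀ , λ _ _ → z≤n
... | no ¬p₀ with least (P? ∘ suc) n p
...   | m , pₘ , min = suc m , pₘ , λ where
          zero    p₀ → contradiction p₀ ¬p₀
          (suc k) pₖ → s≤s (min k pₖ)

MinimumSize : ∀ {n} → Pred (Subset n) 0ℓ → Pred (Subset n) 0ℓ
MinimumSize P S = P S × (∀ T → P T → ∣ S ∣ ≤ ∣ T ∣)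

minimumSize : ∀ {n} {P : Pred (Subset n) 0ℓ} →
              Pred.Decidable P → ∃ P → ∃ (MinimumSize P)
minimumSize P? (T , pT)
  with least (λ k → anySubset? (λ S → P? S ×-dec (∣ S ∣ ℕ.≟ k)))
             ∣ T ∣ (T , pT , refl)
... | _ , (S , pS , refl) , min = S , pS , λ U pU → min ∣ U ∣ (U , pU , refl)

------------------------------------------------------------------------
-- Finite simple graphs

-- The empty graph is not excluded: wherever it matters, the hypotheses
-- provide a vertex.  Decidability of adjacency and the enumeration of the
-- vertices are the constructive content of finiteness.
record Graph : Set₁ where
  infix 4 _~_ _~?_ _∈ᵥ_ _≟_
  field
    V        : Set
    order    : ℕ
    enum     : V ↔ Fin order
    _~_      : Rel V 0ℓ
    _~?_     : Decidable _~_
    ~-sym    : ∀ {x y} → x ~ y → y ~ x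
    ~-irrefl : ∀ {x} → ¬ (x ~ x)

  index : V → Fin order
  index = Inverse.to enum

  vertexAt : Fin order → V
  vertexAt = Inverse.from enum

  vertices : List V
  vertices = map vertexAt (allFin order)

  VertexSet : Set
  VertexSet = Subset order

  _∈ᵥ_ : V → VertexSet → Set
  x ∈ᵥ S = index x ∈ S

  _≟_ : DecidableEquality V
  _≟_ = via-injection (↔⇒↣ enum) Fin._≟_

  vertexAt-index : ∀ x → vertexAt (index x) ≡ x
  vertexAt-index = Inverse.strictlyInverseʳ enum

  anyVertex? : ∀ {P : Pred V 0ℓ} → Pred.Decidable P → Dec (∃ P)
  anyVertex? {P} P? = map′
    (λ (i , p) → vertexAt i , p)
    (λ (x , p) → index x , subst P (sym (vertexAt-index x)) p)
    (Fin.any? (P? ∘ vertexAt))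

  allVertices? : ∀ {P : Pred V 0ℓ} → Pred.Decidable P → Dec (∀ x → P x)
  allVertices? {P} P? = map′
    (λ p x → subst P (vertexAt-index x) (p (index x)))
    (λ p i → p (vertexAt i))
    (Fin.all? (P? ∘ vertexAt))

------------------------------------------------------------------------
-- Walks and distance

module _ (G : Graph) where
  open Graph G

  data Walk : ℕ → V → V → Set where
    []  : ∀ {x} → Walk 0 x x
    _∷_ : ∀ {k x y z} → x ~ y → Walk k y z → Walk (suc k) x z

  Joined : Rel V 0ℓ
  Joined x y = ∃[ k ] Walk k x y

  Connected : Set
  Connected = ∀ x y → Joined x y

  IsDistance : V → V → ℕ∞ → Set
  IsDistance x y [ k ] = Least (λ m → Walk m x y) k
  IsDistance x y ∞     = ¬ Joined x y

module _ {G : Graph} where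
  open Graph G

  walk? : ∀ k x y → Dec (Walk G k x y)
  walk? zero    x y = map′ (λ { refl → [] }) (λ { [] → refl }) (x ≟ y)
  walk? (suc k) x y = map′
    (λ (_ , e , w) → e ∷ w)
    (λ { (e ∷ w) → _ , e , w })
    (anyVertex? (λ z → (x ~? z) ×-dec walk? k z y))

  private
    at : ∀ {k x y} → Walk G k x y → Fin (suc k) → V
    at {x = x} w       zero    = x
    at         (e ∷ w) (suc i) = at w i

    drop : ∀ {k x y} (w : Walk G k x y) i →
           ∃[ l ] toℕ i + l ≡ k × Walk G l (at w i) y
    drop w       zero    = _ , refl , w
    drop (e ∷ w) (suc i) with drop w i
    ... | l , eq , w′ = l , cong suc eq , w′

    prefix : ∀ {k x y l z} (w : Walk G k x y) i →
             Walk G l (at w i) z → Walk G (toℕ i + l) x z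
    prefix w       zero    v = v
    prefix (e ∷ w) (suc i) v = e ∷ prefix w i v

  shorten : ∀ {k x y} → Walk G k x y → ∃[ l ] l < order × Walk G l x y
  shorten {k} = <-rec Q step k
    where
    Q : Pred ℕ 0ℓ
    Q k = ∀ {x y} → Walk G k x y → ∃[ l ] l < order × Walk G l x y

    step : ∀ k → (∀ {j} → j < k → Q j) → Q k
    step k rec {y = y} w with k ℕ.<? order
    ... | yes k<n = k , k<n , w
    ... | no  k≮n with Fin.pigeonhole (s≤s (ℕ.≮⇒≥ k≮n)) (index ∘ at w)
    ...   | i , j , i<j , eq with drop w j
    ...     | l , j+l≡k , v =
      rec (subst (toℕ i + l <_) j+l≡k (ℕ.+-monoˡ-< l i<j)) (prefix w i v′)
      where
      at≡ : at w j ≡ at w i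
      at≡ = trans (sym (vertexAt-index _))
              (trans (cong vertexAt (sym eq)) (vertexAt-index _))
      v′ : Walk G l (at w i) y
      v′ = subst (λ z → Walk G l z y) at≡ v

  joined? : Decidable (Joined G)
  joined? x y = map′
    (λ (i , w) → toℕ i , w)
    (λ (_ , w) → case shorten w of λ where
      (l , l<n , v) → Fin.fromℕ< l<n ,
        subst (λ m → Walk G m x y) (sym (Fin.toℕ-fromℕ< l<n)) v)
    (Fin.any? (λ i → walk? (toℕ i) x y))

opaque
  distance : (G : Graph) (x y : Graph.V G) → ∃ (IsDistance G x y)
  distance G x y with joined? {G} x y
  ... | no ¬j       = ∞ , ¬j
  ... | yes (k , w) with least (λ m → walk? {G} m x y) k w
  ...   | d , d-least = [ d ] , d-least

module _ (G : Graph) where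
  open Graph G

  dist : V → V → ℕ∞
  dist x y = proj₁ (distance G x y)

  dist-spec : ∀ x y → IsDistance G x y (dist x y)
  dist-spec x y = proj₂ (distance G x y)

  dist₂ : V → V → ℕ∞
  dist₂ x y = dist x y ⊓∞ [ 2 ]

  eccentricity : V → ℕ∞
  eccentricity x = max∞ [ 0 ] (map (dist x) vertices)

  -- ∞ for the graph without vertices.
  radius : ℕ∞
  radius = min∞ ∞ (map eccentricity vertices)

------------------------------------------------------------------------
-- Local metric dimension and local adjacency bases

module _ (G : Graph) where
  open Graph G

  Distinguishes : (V → V → ℕ∞) → V → V → V → Set
  Distinguishes d s x y = d s x ≢ d s y

  DistinguishesAdjacent : (V → V → ℕ∞) → Pred VertexSet 0ℓ
  DistinguishesAdjacent d S =
    ∀ x y → x ~ y → ∃[ s ] s ∈ᵥ S × Distinguishes d s x y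

  LocalMetricGenerator : Pred VertexSet 0ℓ
  LocalMetricGenerator = DistinguishesAdjacent (dist G)

  LocalAdjacencyGenerator : Pred VertexSet 0ℓ
  LocalAdjacencyGenerator = DistinguishesAdjacent (dist₂ G)

  LocalAdjacencyBasis : Pred VertexSet 0ℓ
  LocalAdjacencyBasis = MinimumSize LocalAdjacencyGenerator

  private
    localMetricGenerator? : Pred.Decidable LocalMetricGenerator
    localMetricGenerator? S = allVertices? λ x → allVertices? λ y →
      (x ~? y) →-dec anyVertex? λ s →
        (index s ∈? S) ×-dec ¬? (dist G s x ≟∞ dist G s y)

    ⊤-localMetricGenerator : LocalMetricGenerator ⊤
    ⊤-localMetricGenerator x y x~y = x , ∈⊤ , λ eq →
      d≢ (dist G x x) (dist G x y) (dist-spec G x x) (dist-spec G x y) eq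
      where
      d≢ : ∀ d e → IsDistance G x x d → IsDistance G x y e → d ≢ e
      d≢ ∞     _ ¬j        _        _    = ¬j (0 , [])
      d≢ [ k ] _ (w , min) (w′ , _) refl with min 0 [] | w′
      ... | z≤n | [] = ~-irrefl x~y

  opaque
    localMetricBasis : ∃ (MinimumSize LocalMetricGenerator)
    localMetricBasis =
      minimumSize localMetricGenerator? (⊤ , ⊤-localMetricGenerator)

  dimₗ : ℕ
  dimₗ = ∣ proj₁ localMetricBasis ∣

  -- Membership in the class 𝒢.
  𝒢 : Set
  𝒢 = ∀ B → LocalAdjacencyBasis B → ∃[ v ] (∀ x → x ∈ᵥ B → v ~ x)

------------------------------------------------------------------------
-- True twins, bipartiteness, components

module _ (G : Graph) where
  open Graph G

  NonEmpty : Set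
  NonEmpty = ∃[ x ] ∃[ y ] x ~ y

  N[_]∋_ : V → V → Set
  N[ x ]∋ z = z ≡ x ⊎ x ~ z

  TrueTwins : Rel V 0ℓ
  TrueTwins x y = ∀ z → N[ x ]∋ z ⇔ N[ y ]∋ z

  Bipartite : Set
  Bipartite = Σ (V → Bool) λ colour → ∀ x y → x ~ y → colour x ≢ colour y

  Component : Pred VertexSet 0ℓ
  Component C = ∃[ x ] (∀ y → y ∈ᵥ C ⇔ Joined G x y)

  NonTrivialComponent : Pred VertexSet 0ℓ
  NonTrivialComponent C = Component C × 2 ≤ ∣ C ∣

------------------------------------------------------------------------
-- Induced subgraphs

Σ∈↔Fin : ∀ {n} (S : Subset n) → Σ (Fin n) (_∈ S) ↔ Fin ∣ S ∣
Σ∈↔Fin []            = mk↔ₛ′ (λ ()) (λ ()) (λ ()) (λ ())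
Σ∈↔Fin (outside ∷ S) = ↔-trans
  (mk↔ₛ′ (λ { (suc i , there i∈S) → i , i∈S })
         (λ (i , i∈S) → suc i , there i∈S)
         (λ _ → refl)
         (λ { (suc i , there i∈S) → refl }))
  (Σ∈↔Fin S)
Σ∈↔Fin (inside ∷ S)  = ↔-trans
  (mk↔ₛ′ (λ { (zero , here) → inj₁ zero
            ; (suc i , there i∈S) → inj₂ (i , i∈S) })
         (λ { (inj₁ zero) → zero , here
            ; (inj₂ (i , i∈S)) → suc i , there i∈S })
         (λ { (inj₁ zero) → refl ; (inj₂ _) → refl })
         (λ { (zero , here) → refl ; (suc i , there i∈S) → refl }))
  (↔-trans (↔-refl ⊎-↔ Σ∈↔Fin S) (↔-sym (Fin.+↔⊎ {1})))

induced : (G : Graph) → Graph.VertexSet G → Graph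
induced G S = record
  { V        = Σ V (_∈ᵥ S)
  ; order    = ∣ S ∣
  ; enum     = ↔-trans (Σ-↔ enum ↔-refl) (Σ∈↔Fin S)
  ; _~_      = λ (x , _) (y , _) → x ~ y
  ; _~?_     = λ (x , _) (y , _) → x ~? y
  ; ~-sym    = ~-sym
  ; ~-irrefl = ~-irrefl
  }
  where open Graph G

UniqueNonTrivialComponentOfRadius≤ : Graph → ℕ → Set
UniqueNonTrivialComponentOfRadius≤ G r =
  Σ (∃! _≡_ (NonTrivialComponent G)) λ (C , _) →
    radius (induced G C) ≤∞ [ r ]

------------------------------------------------------------------------
-- Lexicographic product

sumᵥ : ∀ {n} → Vector ℕ n → ℕ
sumᵥ = Vector.foldr _+_ 0

ΣFin↔Fin : ∀ {n} (m : Vector ℕ n) → Σ (Fin n) (Fin ∘ m) ↔ Fin (sumᵥ m)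
ΣFin↔Fin {zero}  m = mk↔ₛ′ (λ ()) (λ ()) (λ ()) (λ ())
ΣFin↔Fin {suc n} m = ↔-trans
  (mk↔ₛ′ (λ { (zero , j) → inj₁ j ; (suc i , j) → inj₂ (i , j) })
         (λ { (inj₁ j) → zero , j ; (inj₂ (i , j)) → suc i , j })
         (λ { (inj₁ _) → refl ; (inj₂ _) → refl })
         (λ { (zero , _) → refl ; (suc _ , _) → refl }))
  (↔-trans (↔-refl ⊎-↔ ΣFin↔Fin (m ∘ suc)) (↔-sym (Fin.+↔⊎ {m zero})))

module _ (G : Graph) (H : Graph.V G → Graph) where
  private
    module G = Graph G
    module H u = Graph (H u)

  data Lex~ : Rel (Σ G.V H.V) 0ℓ where
    outer : ∀ {u u′ v w} → u G.~ u′ → Lex~ (u , v) (u′ , w)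
    inner : ∀ {u v w} → H._~_ u v w → Lex~ (u , v) (u , w)

  private
    lex? : Decidable Lex~
    lex? (u , v) (u′ , w) with u G.~? u′
    ... | yes e = yes (outer e)
    ... | no ¬e with u G.≟ u′
    ...   | no u≢u′ = no λ { (outer e) → ¬e e ; (inner _) → u≢u′ refl }
    ...   | yes refl = map′ inner
              (λ { (outer e) → contradiction e ¬e ; (inner e) → e })
              (H._~?_ u v w)

  infix 8 _⊚_
  _⊚_ : Graph
  _⊚_ = record
    { V        = Σ G.V H.V
    ; order    = sumᵥ (H.order ∘ G.vertexAt)
    ; enum     = ↔-trans (↔-sym (Σ-↔ (↔-sym G.enum) ↔-refl))
                   (↔-trans (Σ-↔ ↔-refl (λ {i} → H.enum (G.vertexAt i)))
                            (ΣFin↔Fin (H.order ∘ G.vertexAt)))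
    ; _~_      = Lex~
    ; _~?_     = lex?
    ; ~-sym    = λ { (outer e) → outer (G.~-sym e)
                   ; (inner e) → inner (H.~-sym _ e) }
    ; ~-irrefl = λ { (outer e) → G.~-irrefl e
                   ; (inner e) → H.~-irrefl _ e }
    }

-- The true twin class of u is { x | TrueTwins G u x }.
AtMostOne𝒢PerTwinClass : (G : Graph) → (Graph.V G → Graph) → Set
AtMostOne𝒢PerTwinClass G H = ∀ u x y →
  TrueTwins G u x → TrueTwins G u y → 𝒢 (H x) → 𝒢 (H y) → x ≡ y

{-# OPTIONS --safe #-}

-- A fibre of G ⊚ H only sees distances truncated at 2, and an edge inside a
-- fibre is distinguished only by vertices of that fibre.  So every local metric
-- generator meets each of the n fibres, and dimension n means that it meets
-- each fibre in a single vertex.  A single vertex s distinguishes all edges of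
-- H u with respect to truncated distance iff each edge has exactly one end
-- adjacent to s; then s is a centre of the only non-trivial component, which
-- has radius at most 2, and adjacency to s is a 2-colouring.  Such an s is
-- never isolated, hence H u ∈ 𝒢, and an edge between two different fibres is
-- then left undistinguished only over true twins of G.
module Submission where

import Algebra.Construct.NaturalChoice.Min as Min
open import Defs
open import Data.Bool.Base using (Bool; true)
import Data.Bool.Properties as Bool
open import Data.Fin.Base using (Fin; zero; suc)
import Data.Fin.Properties as Fin
open import Data.Fin.Subset using (_∈_; ∣_∣; ⁅_⁆)
open import Data.Fin.Subset.Properties
  using (_∈?_; ⊆-antisym; x∈⁅x⁆; ∣⁅x⁆∣≡1)
open import Data.List.Base using (map)
import Data.List.Extrema as Extrema
open import Data.List.Membership.Propositional using (lose) renaming (_∈_ to _∈ˡ_)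
open import Data.List.Membership.Propositional.Properties
  using (∈-map⁺; ∈-map⁻; ∈-allFin)
import Data.List.Relation.Unary.All as All
open import Data.Nat.Base using (suc; _≤_; z≤n; s≤s)
import Data.Nat.Properties as ℕ
open import Data.Product using (Σ; ∃; ∃-syntax; _×_; _,_; proj₁; proj₂)
open import Data.Sum.Base as Sum using (_⊎_; inj₁; inj₂)
open import Data.Vec.Base using (tabulate)
open import Data.Vec.Properties using ([]=⇒lookup; lookup⇒[]=; lookup∘tabulate)
open import Data.Vec.Properties.WithK using ([]=-irrelevant)
open import Function.Base using (_∘_; id)
open import Function.Bundles using (_↔_; _⇔_; Inverse; Equivalence; Injection; mk⇔)
open import Function.Definitions using (Injective)
open import Function.Properties.Inverse using (↔-refl; ↔-sym; ↔⇒↣)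
import Function.Properties.Equivalence as ⇔
open import Level using (0ℓ)
open import Relation.Binary.Bundles using (TotalOrder)
open import Relation.Binary.Construct.Add.Supremum.NonStrict _≤_ using ([_]; _≤⊤⁺)
open import Relation.Binary.PropositionalEquality
open import Relation.Nullary.Construct.Add.Supremum using ([_])
open import Relation.Nullary.Decidable
  using (Dec; yes; no; does; dec-true; dec-false; ¬?; _×-dec_; _⊎-dec_; decidable-stable)
open import Relation.Nullary.Negation using (¬_; contradiction)
open import Relation.Unary as Pred using (Pred)

open Equivalence using (to; from)

private
  module ≤∞ = TotalOrder ≤∞-totalOrder

↔-to-injective : ∀ {A B : Set} (e : A ↔ B) → Injective _≡_ _≡_ (Inverse.to e)
↔-to-injective e = Injection.injective (↔⇒↣ e)

↔-from-injective : ∀ {A B : Set} (e : A ↔ B) → Injective _≡_ _≡_ (Inverse.from e)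
↔-from-injective e = ↔-to-injective (↔-sym e)

-- Vertex sets

module _ (K : Graph) where
  open Graph K

  private
    does⇒ : ∀ {A : Set} (a? : Dec A) → does a? ≡ true → A
    does⇒ (yes a) _ = a

  subset : {P : Pred V 0ℓ} → Pred.Decidable P → VertexSet
  subset P? = tabulate (does ∘ P? ∘ vertexAt)

  ∈-subset : ∀ {P : Pred V 0ℓ} (P? : Pred.Decidable P) {x} → x ∈ᵥ subset P? ⇔ P x
  ∈-subset {P} P? {x} = mk⇔
    (λ x∈ → subst P (vertexAt-index x) (does⇒ (P? (vertexAt (index x)))
      (trans (sym (lookup∘tabulate _ (index x))) ([]=⇒lookup x∈))))
    (λ p → lookup⇒[]= (index x) _
      (trans (lookup∘tabulate _ (index x))
             (dec-true (P? _) (subst P (sym (vertexAt-index x)) p))))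

  vertexSet-ext : ∀ {S T} → (∀ x → x ∈ᵥ S ⇔ x ∈ᵥ T) → S ≡ T
  vertexSet-ext S⇔T = ⊆-antisym (⊆ S⇔T) (⊆ (λ x → ⇔.sym (S⇔T x)))
    where
    ⊆ : ∀ {S T} → (∀ x → x ∈ᵥ S ⇔ x ∈ᵥ T) → ∀ {i} → i ∈ S → i ∈ T
    ⊆ {S} {T} S⇔T {i} i∈S =
      subst (_∈ T) i≡ (to (S⇔T (vertexAt i)) (subst (_∈ S) (sym i≡) i∈S))
      where
      i≡ : index (vertexAt i) ≡ i
      i≡ = Inverse.strictlyInverseˡ enum i

  ≤-card : ∀ {A : Set} {m S} → A ↔ Fin m → (f : A → V) → Injective _≡_ _≡_ f →
           (∀ a → f a ∈ᵥ S) → m ≤ ∣ S ∣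
  ≤-card {S = S} e f f-inj f∈S = Fin.injective⇒≤
    {f = λ i → Inverse.to (Σ∈↔Fin S) (_ , f∈S (Inverse.from e i))}
    (↔-from-injective e ∘ f-inj ∘ ↔-to-injective enum ∘ cong proj₁
      ∘ ↔-to-injective (Σ∈↔Fin S))

  card-≤ : ∀ {A : Set} {m S} → A ↔ Fin m → (f : V → A) →
           (∀ {x y} → x ∈ᵥ S → y ∈ᵥ S → f x ≡ f y → x ≡ y) → ∣ S ∣ ≤ m
  card-≤ {S = S} e f f-inj = Fin.injective⇒≤
    {f = Inverse.to e ∘ f ∘ vertexAt ∘ proj₁ ∘ Inverse.from (Σ∈↔Fin S)}
    (λ eq → ↔-from-injective (Σ∈↔Fin S) (Σ-inj (↔-to-injective e eq)))
    where
    index∈ : ∀ {i} → i ∈ S → vertexAt i ∈ᵥ S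
    index∈ = subst (_∈ S) (sym (Inverse.strictlyInverseˡ enum _))

    Σ-inj : ∀ {p q : Σ _ (_∈ S)} →
            f (vertexAt (proj₁ p)) ≡ f (vertexAt (proj₁ q)) → p ≡ q
    Σ-inj {i , i∈} {j , j∈} eq
      with ↔-from-injective enum (f-inj (index∈ i∈) (index∈ j∈) eq)
    ... | refl = cong (i ,_) ([]=-irrelevant i∈ j∈)

  -- A missed element `x` of `S` would extend `f` to an injection of `suc m` elements into a set of
  -- size at most `m`.
  injection-onto : ∀ {A : Set} {m S} → A ↔ Fin m → (f : A → V) → Injective _≡_ _≡_ f →
                   (∀ a → f a ∈ᵥ S) → ∣ S ∣ ≤ m → ∀ {x} → x ∈ᵥ S → ∃[ a ] f a ≡ x
  injection-onto {m = m} {S} e f f-inj f∈S S≤m {x} x∈S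
    with Fin.any? (λ i → f (Inverse.from e i) ≟ x)
  ... | yes (i , eq) = _ , eq
  ... | no ∄i = contradiction (ℕ.≤-trans (≤-card ↔-refl g g-inj g∈S) S≤m) ℕ.1+n≰n
    where
    g : Fin (suc m) → V
    g zero    = x
    g (suc i) = f (Inverse.from e i)

    g-inj : Injective _≡_ _≡_ g
    g-inj {zero}  {zero}  _  = refl
    g-inj {zero}  {suc j} eq = contradiction (j , sym eq) ∄i
    g-inj {suc i} {zero}  eq = contradiction (i , eq) ∄i
    g-inj {suc i} {suc j} eq = cong suc (↔-from-injective e (f-inj eq))

    g∈S : ∀ i → g i ∈ᵥ S
    g∈S zero    = x∈S
    g∈S (suc i) = f∈S _

  ∣S∣≤1⇒≡ : ∀ {S x y} → ∣ S ∣ ≤ 1 → x ∈ᵥ S → y ∈ᵥ S → x ≡ y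
  ∣S∣≤1⇒≡ {x = x} S≤1 x∈S y∈S = proj₂
    (injection-onto ↔-refl (λ (_ : Fin 1) → x) (λ { {zero} {zero} _ → refl })
      (λ _ → x∈S) S≤1 y∈S)

  2≤∣S∣ : ∀ {S x y} → x ∈ᵥ S → y ∈ᵥ S → x ≢ y → 2 ≤ ∣ S ∣
  2≤∣S∣ x∈S y∈S x≢y = ℕ.≰⇒> λ S≤1 → x≢y (∣S∣≤1⇒≡ S≤1 x∈S y∈S)

  ∃≢∈ : ∀ {S} → 2 ≤ ∣ S ∣ → ∀ x → ∃[ y ] y ∈ᵥ S × y ≢ x
  ∃≢∈ {S} 2≤S x with anyVertex? (λ y → (index y ∈? S) ×-dec ¬? (y ≟ x))
  ... | yes p = p
  ... | no ∄y = contradiction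
    (card-≤ ↔-refl (λ _ → zero) λ y∈S z∈S _ → trans (≡x y∈S) (sym (≡x z∈S)))
    (ℕ.<⇒≱ 2≤S)
    where
    ≡x : ∀ {y} → y ∈ᵥ S → y ≡ x
    ≡x {y} y∈S = decidable-stable (y ≟ x) λ y≢x → ∄y (y , y∈S , y≢x)

-- Walks and distances

module _ (K : Graph) where
  open Graph K

  infixl 5 _∷ʳ_ _++ʷ_
  _∷ʳ_ : ∀ {k x y z} → Walk K k x y → y ~ z → Walk K (suc k) x z
  []      ∷ʳ f = f ∷ []
  (e ∷ w) ∷ʳ f = e ∷ (w ∷ʳ f)

  reverse : ∀ {k x y} → Walk K k x y → Walk K k y x
  reverse []      = []
  reverse (e ∷ w) = reverse w ∷ʳ ~-sym e

  _++ʷ_ : ∀ {k l x y z} → Walk K k x y → Walk K l y z → Joined K x z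
  []      ++ʷ v = _ , v
  (e ∷ w) ++ʷ v = _ , e ∷ proj₂ (w ++ʷ v)

  joined-trans : ∀ {x y z} → Joined K x y → Joined K y z → Joined K x z
  joined-trans (_ , w) (_ , v) = w ++ʷ v

  joined-sym : ∀ {x y} → Joined K x y → Joined K y x
  joined-sym (_ , w) = _ , reverse w

  ~⇒joined : ∀ {x y} → x ~ y → Joined K x y
  ~⇒joined e = _ , e ∷ []

  joined⇒neighbour : ∀ {x y} → Joined K x y → x ≢ y → ∃[ z ] x ~ z
  joined⇒neighbour (_ , [])    x≢y = contradiction refl x≢y
  joined⇒neighbour (_ , e ∷ _) _   = _ , e

  ~⇒≢ : ∀ {x y} → x ~ y → x ≢ y
  ~⇒≢ e refl = ~-irrefl e

  -- The distances enter as variables with their specifications: `distance` is opaque, and here the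
  -- cases finite and infinite can be matched on directly.
  isDistance-≤ : ∀ {s x y} d e → IsDistance K s x d → IsDistance K s y e →
                 (∀ {k} → Walk K k s y → ∃[ l ] l ≤ k × Walk K l s x) → d ≤∞ e
  isDistance-≤ _     ∞     _         _       _ = _ ≤⊤⁺
  isDistance-≤ ∞     [ _ ] ¬j        (w , _) f =
    let l , _ , v = f w in contradiction (l , v) ¬j
  isDistance-≤ [ _ ] [ _ ] (_ , min) (w , _) f =
    let l , l≤ , v = f w in [ ℕ.≤-trans (min l v) l≤ ]

  dist-unique : ∀ {x y} d → IsDistance K x y d → dist K x y ≡ d
  dist-unique {x} {y} d spec = ≤∞.antisym
    (isDistance-≤ _ d (dist-spec K x y) spec (λ w → _ , ℕ.≤-refl , w))
    (isDistance-≤ d _ spec (dist-spec K x y) (λ w → _ , ℕ.≤-refl , w))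

  -- Distances are measured from `s`, while modifying a walk is easiest at its first step; so the
  -- walks are reversed to start at the vertices being compared.
  dist-≤ : ∀ {s x y} → (∀ {k} → Walk K k y s → ∃[ l ] l ≤ k × Walk K l x s) →
           dist K s x ≤∞ dist K s y
  dist-≤ {s} {x} {y} f = isDistance-≤ _ _ (dist-spec K s x) (dist-spec K s y)
    (λ w → let l , l≤ , v = f (reverse w) in l , l≤ , reverse v)

  dist≤⇒walk : ∀ {x y k} → dist K x y ≤∞ [ k ] → ∃[ l ] l ≤ k × Walk K l x y
  dist≤⇒walk {x} {y} d≤k = go _ (dist-spec K x y) d≤k
    where
    go : ∀ {k} d → IsDistance K x y d → d ≤∞ [ k ] → ∃[ l ] l ≤ k × Walk K l x y
    go [ l ] (w , _) [ l≤k ] = l , l≤k , w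

  walk⇒dist≤ : ∀ {x y l k} → l ≤ k → Walk K l x y → dist K x y ≤∞ [ k ]
  walk⇒dist≤ {x} {y} {l} {k} l≤k w = go _ (dist-spec K x y)
    where
    go : ∀ d → IsDistance K x y d → d ≤∞ [ k ]
    go [ _ ] (_ , min) = [ ℕ.≤-trans (min l w) l≤k ]
    go ∞     ¬j        = contradiction (l , w) ¬j

  dist-self : ∀ {x} → dist K x x ≡ [ 0 ]
  dist-self = dist-unique [ 0 ] ([] , λ _ _ → z≤n)

  dist-adjacent : ∀ {x y} → x ~ y → dist K x y ≡ [ 1 ]
  dist-adjacent e = dist-unique [ 1 ]
    (e ∷ [] , λ { _ [] → contradiction e ~-irrefl ; _ (_ ∷ _) → s≤s z≤n })

  dist≡1⇒adjacent : ∀ {x y} → dist K x y ≡ [ 1 ] → x ~ y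
  dist≡1⇒adjacent {x} {y} eq
    with subst (IsDistance K x y) eq (dist-spec K x y)
  ... | e ∷ [] , _ = e

  nonadjacent⇒2≤ : ∀ {x y} → x ≢ y → ¬ x ~ y → ∀ k → Walk K k x y → 2 ≤ k
  nonadjacent⇒2≤ x≢y x≁y _ []            = contradiction refl x≢y
  nonadjacent⇒2≤ x≢y x≁y _ (e ∷ [])      = contradiction e x≁y
  nonadjacent⇒2≤ x≢y x≁y _ (_ ∷ (_ ∷ _)) = s≤s (s≤s z≤n)

-- Distances truncated at 2

-- Satisfied both by `dist₂ K` and by the distance of a lexicographic product within one fibre, so
-- that the criterion for distinguishing an edge is shared.
record Truncated (K : Graph) (d : Graph.V K → Graph.V K → ℕ∞) : Set where
  open Graph K
  field
    self : ∀ {x} → d x x ≡ [ 0 ]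
    near : ∀ {x y} → x ~ y → d x y ≡ [ 1 ]
    far  : ∀ {x y} → x ≢ y → ¬ x ~ y → d x y ≡ [ 2 ]

ExactlyOneAdjacent : (K : Graph) (s x y : Graph.V K) → Set
ExactlyOneAdjacent K s x y = (s ~ x × ¬ s ~ y) ⊎ (s ~ y × ¬ s ~ x)
  where open Graph K

-- Equivalently, the singleton of `s` is a local adjacency generator of `K`.
Splits : (K : Graph) → Graph.V K → Set
Splits K s = ∀ x y → Graph._~_ K x y → ExactlyOneAdjacent K s x y

module _ (K : Graph) where
  open Graph K

  dist₂-truncated : Truncated K (dist₂ K)
  dist₂-truncated = record
    { self = cong (_⊓∞ [ 2 ]) (dist-self K)
    ; near = λ e → cong (_⊓∞ [ 2 ]) (dist-adjacent K e)
    ; far  = λ x≢y x≁y → far _ (dist-spec K _ _) (nonadjacent⇒2≤ K x≢y x≁y)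
    }
    where
    far : ∀ {x y} d → IsDistance K x y d → (∀ k → Walk K k x y → 2 ≤ k) →
          d ⊓∞ [ 2 ] ≡ [ 2 ]
    far ∞     _       _  = refl
    far [ k ] (w , _) 2≤ = Min.x≤y⇒y⊓x≈x ≤∞-totalOrder [ 2≤ k w ]

  module _ {d : V → V → ℕ∞} (trunc : Truncated K d) {s x y : V} where
    open Truncated trunc

    -- The end adjacent to `s` has distance 1, the other one 0 or 2.
    exactlyOne⇒distinguishes : ExactlyOneAdjacent K s x y → Distinguishes K d s x y
    exactlyOne⇒distinguishes = Sum.[ (λ (p , q) → 1≢ p q) , (λ (p , q) → 1≢ p q ∘ sym) ]
      where
      1≢ : ∀ {x y} → s ~ x → ¬ s ~ y → d s x ≢ d s y
      1≢ {x} {y} s~x s≁y eq with s ≟ y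
      ... | yes refl = contradiction (trans (sym (near s~x)) (trans eq self)) λ ()
      ... | no s≢y = contradiction (trans (sym (near s~x)) (trans eq (far s≢y s≁y))) λ ()

    -- If `s` is adjacent to both ends, both distances are 1. If to neither, `s` is not an end
    -- itself, since each end is adjacent to the other, and both distances are 2.
    distinguishes⇒exactlyOne : x ~ y → Distinguishes K d s x y → ExactlyOneAdjacent K s x y
    distinguishes⇒exactlyOne x~y d≢ with s ~? x | s ~? y
    ... | yes s~x | no s≁y  = inj₁ (s~x , s≁y)
    ... | no s≁x  | yes s~y = inj₂ (s~y , s≁x)
    ... | yes s~x | yes s~y = contradiction (trans (near s~x) (sym (near s~y))) d≢
    ... | no s≁x  | no s≁y  = contradiction
      (trans (far (λ { refl → s≁y x~y }) s≁x)
             (sym (far (λ { refl → s≁x (~-sym x~y) }) s≁y))) d≢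

  exactlyOne⇒neighbour : ∀ {s x y} → ExactlyOneAdjacent K s x y → ∃[ v ] v ~ s
  exactlyOne⇒neighbour (inj₁ (s~x , _)) = _ , ~-sym s~x
  exactlyOne⇒neighbour (inj₂ (s~y , _)) = _ , ~-sym s~y

  splits⇒neighbour : ∀ {s} → NonEmpty K → Splits K s → ∃[ v ] v ~ s
  splits⇒neighbour (x , y , x~y) split = exactlyOne⇒neighbour (split x y x~y)

  -- By comparison with the singleton of `s`, a basis has at most one element. That element
  -- distinguishes some edge, so it has a neighbour, which is then adjacent to the whole basis.
  splits⇒𝒢 : ∀ {s} → NonEmpty K → Splits K s → 𝒢 K
  splits⇒𝒢 {s} (x , y , x~y) split B (gen , min)
    with t , t∈B , d≢ ← gen x y x~y
    with v , v~t ← exactlyOne⇒neighbour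
                     (distinguishes⇒exactlyOne dist₂-truncated x~y d≢)
    = v , λ z z∈B → subst (v ~_) (∣S∣≤1⇒≡ K B≤1 t∈B z∈B) v~t
    where
    B≤1 : ∣ B ∣ ≤ 1
    B≤1 = subst (∣ B ∣ ≤_) (∣⁅x⁆∣≡1 (index s))
      (min ⁅ index s ⁆ λ x y x~y → s , x∈⁅x⁆ _ ,
        exactlyOne⇒distinguishes dist₂-truncated (split x y x~y))

-- Components and radius

module _ (K : Graph) where
  open Graph K

  ∈-vertices : ∀ x → x ∈ˡ vertices
  ∈-vertices x = subst (_∈ˡ vertices) (vertexAt-index x)
    (∈-map⁺ vertexAt (∈-allFin (index x)))

  eccentricity≤⁺ : ∀ {c k} → (∀ x → dist K c x ≤∞ [ k ]) → eccentricity K c ≤∞ [ k ]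
  -- The argument `[ z≤n ]` bounds 0, the default value of the maximum.
  eccentricity≤⁺ {c} d≤k = Extrema.max≤v⁺ ≤∞-totalOrder {xs = map (dist K c) vertices} [ z≤n ]
    (All.tabulate λ d∈ → let x , _ , eq = ∈-map⁻ (dist K c) d∈ in
      subst (_≤∞ _) (sym eq) (d≤k x))

  eccentricity≤⁻ : ∀ {c k} → eccentricity K c ≤∞ k → ∀ x → dist K c x ≤∞ k
  eccentricity≤⁻ {c} e≤k x = ≤∞.trans
    (All.lookup (Extrema.xs≤max ≤∞-totalOrder [ 0 ] _)
      (∈-map⁺ (dist K c) (∈-vertices x)))
    e≤k

  radius≤⁺ : ∀ {c k} → eccentricity K c ≤∞ k → radius K ≤∞ k
  radius≤⁺ {c} e≤k = Extrema.min≤v⁺ ≤∞-totalOrder ∞ _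
    (inj₂ (lose (∈-map⁺ (eccentricity K) (∈-vertices c)) e≤k))

  radius≤⁻ : ∀ {k} → radius K ≤∞ [ k ] → ∃[ c ] eccentricity K c ≤∞ [ k ]
  radius≤⁻ r≤k with Extrema.argmin-sel ≤∞-totalOrder id ∞ (map (eccentricity K) vertices)
  -- A finite bound rules out the default value `∞` of the minimum, so some vertex attains it.
  ... | inj₁ r≡∞ = contradiction (subst (_≤∞ _) r≡∞ r≤k) λ ()
  ... | inj₂ r∈  = let c , _ , r≡ = ∈-map⁻ (eccentricity K) r∈ in
    c , subst (_≤∞ _) r≡ r≤k

-- Splitting vertices as centres of the non-trivial component

module _ (K : Graph) where
  open Graph K

  componentOf : V → VertexSet
  componentOf x = subset K (joined? {K} x)

  ∈-componentOf : ∀ {x y} → y ∈ᵥ componentOf x ⇔ Joined K x y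
  ∈-componentOf {x} = ∈-subset K (joined? {K} x)

  edge-nonTrivial : ∀ {x y} → x ~ y → NonTrivialComponent K (componentOf x)
  edge-nonTrivial {x} x~y =
    (x , λ _ → ∈-componentOf) ,
    2≤∣S∣ K (from ∈-componentOf (0 , [])) (from ∈-componentOf (~⇒joined K x~y)) (~⇒≢ K x~y)

  splits⇒bipartite : ∀ {s} → Splits K s → Bipartite K
  splits⇒bipartite {s} split = (λ x → does (s ~? x)) , proper
    where
    true≢false : ∀ {x y} → s ~ x → ¬ s ~ y → does (s ~? x) ≢ does (s ~? y)
    true≢false s~x s≁y eq = contradiction
      (trans (sym (dec-true (s ~? _) s~x)) (trans eq (dec-false (s ~? _) s≁y))) λ ()

    proper : ∀ x y → x ~ y → does (s ~? x) ≢ does (s ~? y)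
    proper x y x~y with split x y x~y
    ... | inj₁ (s~x , s≁y) = true≢false s~x s≁y
    ... | inj₂ (s~y , s≁x) = true≢false s~y s≁x ∘ sym

  module _ {s : V} (split : Splits K s) where
    private
      C = componentOf s

    -- One end of the edge is adjacent to `s`, so `s` reaches `x` in one step, or in two steps
    -- through `y`.
    splits⇒joined : ∀ {x y} → x ~ y → Joined K s x
    splits⇒joined {x} {y} x~y with split x y x~y
    ... | inj₁ (s~x , _) = _ , s~x ∷ []
    ... | inj₂ (s~y , _) = _ , s~y ∷ (~-sym x~y ∷ [])

    -- A second vertex in `D` gives its representative `x` a neighbour; an edge at `x` forces `x`
    -- into the component of `s`.
    splits⇒component-unique : ∀ {D} → NonTrivialComponent K D → C ≡ D
    splits⇒component-unique {D} ((x , x-comp) , 2≤D)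
      with y , y∈D , y≢x ← ∃≢∈ K 2≤D x
      with _ , x~z ← joined⇒neighbour K (to (x-comp y) y∈D) (y≢x ∘ sym)
      = vertexSet-ext K λ z → mk⇔
          (λ z∈C → from (x-comp z)
            (joined-trans K (joined-sym K s⋯x) (to ∈-componentOf z∈C)))
          (λ z∈D → from ∈-componentOf (joined-trans K s⋯x (to (x-comp z) z∈D)))
      where
      s⋯x = splits⇒joined x~z

    splits⇒walk≤2 : ∀ {x} (s∈C : s ∈ᵥ C) (x∈C : x ∈ᵥ C) →
                    ∃[ l ] l ≤ 2 × Walk (induced K C) l (s , s∈C) (x , x∈C)
    splits⇒walk≤2 {x} s∈C x∈C with s ≟ x
    -- A vertex of the induced graph carries a membership proof; the empty walk needs the two proofs
    -- to be equal as well.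
    ... | yes refl with refl ← []=-irrelevant s∈C x∈C = 0 , z≤n , []
    ... | no s≢x
      with z , x~z ← joined⇒neighbour K (joined-sym K (to ∈-componentOf x∈C)) (s≢x ∘ sym)
      with split x z x~z
    ...   | inj₁ (s~x , _) = 1 , s≤s z≤n , s~x ∷ []
    -- The middle vertex `z` is a neighbour of `s`, so the walk stays inside the component.
    ...   | inj₂ (s~z , _) = 2 , ℕ.≤-refl ,
      _∷_ {y = z , from ∈-componentOf (~⇒joined K s~z)} s~z (~-sym x~z ∷ [])

    splits⇒uniqueComponent : NonEmpty K → UniqueNonTrivialComponentOfRadius≤ K 2
    splits⇒uniqueComponent nonEmpty =
      (C , edge-nonTrivial (~-sym (proj₂ (splits⇒neighbour K nonEmpty split)))
         , splits⇒component-unique) ,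
      radius≤⁺ (induced K C) (eccentricity≤⁺ (induced K C) λ (_ , x∈C) →
        let _ , l≤2 , w = splits⇒walk≤2 s∈C x∈C in walk⇒dist≤ (induced K C) l≤2 w)
      where
      s∈C : s ∈ᵥ C
      s∈C = from ∈-componentOf (0 , [])

  -- Take a centre `c` of the component. Colours alternate along a walk, so a vertex within distance
  -- 2 of `c` and of the other colour is at distance exactly 1, while one of the same colour is not
  -- adjacent to `c`. Every edge has one end of each kind.
  centre⇒splits : Bipartite K → UniqueNonTrivialComponentOfRadius≤ K 2 → ∃ (Splits K)
  centre⇒splits (colour , proper) ((C , _ , unique) , r≤2)
    with (c , c∈C) , ecc≤2 ← radius≤⁻ (induced K C) r≤2
    = c , split
    where
    both≢ : ∀ {a b d : Bool} → a ≢ d → b ≢ d → a ≡ b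
    both≢ a≢d b≢d = trans (Bool.¬-not a≢d) (sym (Bool.¬-not b≢d))

    -- The component of an end of an edge is non-trivial, hence equal to `C` by uniqueness.
    edge∈C : ∀ {x y} → x ~ y → x ∈ᵥ C
    edge∈C x~y = subst (_ ∈ᵥ_) (sym (unique (edge-nonTrivial x~y)))
      (from ∈-componentOf (0 , []))

    adjacent : ∀ {x} → x ∈ᵥ C → colour x ≢ colour c → c ~ x
    adjacent {x} x∈C x≢c
      with dist≤⇒walk (induced K C) (eccentricity≤⁻ (induced K C) ecc≤2 (x , x∈C))
    ... | _ , _ , []           = contradiction refl x≢c
    ... | _ , _ , e ∷ []       = e
    ... | _ , _ , e ∷ (f ∷ []) = contradiction
      (both≢ (≢-sym (proper _ _ f)) (proper _ _ e)) x≢c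
    ... | _ , s≤s (s≤s ()) , _ ∷ (_ ∷ (_ ∷ _))

    nonadjacent : ∀ {x} → colour x ≡ colour c → ¬ c ~ x
    nonadjacent x≡c c~x = proper _ _ c~x (sym x≡c)

    split : Splits K c
    split x y x~y with colour x Bool.≟ colour c | colour y Bool.≟ colour c
    ... | yes x≡c | yes y≡c = contradiction (trans x≡c (sym y≡c)) (proper x y x~y)
    ... | no x≢c  | yes y≡c = inj₁ (adjacent (edge∈C x~y) x≢c , nonadjacent y≡c)
    ... | yes x≡c | no y≢c  = inj₂ (adjacent (edge∈C (~-sym x~y)) y≢c , nonadjacent x≡c)
    ... | no x≢c  | no y≢c  = contradiction (both≢ x≢c y≢c) (proper x y x~y)

-- True twins

module _ (G : Graph) where
  open Graph G

  trueTwins-refl : ∀ {x} → TrueTwins G x x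
  trueTwins-refl _ = ⇔.refl

  trueTwins-sym : ∀ {x y} → TrueTwins G x y → TrueTwins G y x
  trueTwins-sym twins z = ⇔.sym (twins z)

  trueTwins-trans : ∀ {x y z} → TrueTwins G x y → TrueTwins G y z → TrueTwins G x z
  trueTwins-trans twins twins′ z = ⇔.trans (twins z) (twins′ z)

  trueTwins-adjacent : ∀ {x y} → TrueTwins G x y → x ≢ y → x ~ y
  trueTwins-adjacent {y = y} twins x≢y with from (twins y) (inj₁ refl)
  ... | inj₁ y≡x = contradiction (sym y≡x) x≢y
  ... | inj₂ x~y = x~y

  N[_]∋?_ : ∀ x z → Dec (N[_]∋_ G x z)
  N[ x ]∋? z = (z ≟ x) ⊎-dec (x ~? z)

  Separates : (x y z : V) → Set
  Separates x y z = N[_]∋_ G x z × ¬ N[_]∋_ G y z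

  separates? : ∀ x y → Dec (∃ (Separates x y))
  separates? x y = anyVertex? λ z → (N[ x ]∋? z) ×-dec ¬? (N[ y ]∋? z)

  unseparated⇒trueTwins : ∀ {x y} → ¬ ∃ (Separates x y) → ¬ ∃ (Separates y x) →
                          TrueTwins G x y
  unseparated⇒trueTwins {x} {y} ∄xy ∄yx z = mk⇔
    (λ z∈ → decidable-stable (N[ y ]∋? z) λ z∉ → ∄xy (z , z∈ , z∉))
    (λ z∈ → decidable-stable (N[ x ]∋? z) λ z∉ → ∄yx (z , z∈ , z∉))

  connected⇒neighbour : Connected G → 2 ≤ order → ∀ x → ∃[ y ] x ~ y
  connected⇒neighbour connected 2≤n x
    with anyVertex? (λ y → ¬? (y ≟ x))
  ... | yes (y , y≢x) = joined⇒neighbour G (connected x y) (≢-sym y≢x)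
  ... | no ∄y = contradiction
    -- Were `x` the only vertex, the constant map to `Fin 1` would be injective and the order at
    -- most 1.
    (Fin.injective⇒≤ {f = λ (_ : Fin order) → zero {0}}
      λ _ → ↔-from-injective enum (trans (≡x _) (sym (≡x _))))
    (ℕ.<⇒≱ 2≤n)
    where
    ≡x : ∀ y → y ≡ x
    ≡x y = decidable-stable (y ≟ x) λ y≢x → ∄y (y , y≢x)

-- Distances in lexicographic products

module _ (G : Graph) (H : Graph.V G → Graph) where
  private
    module G = Graph G
    module H u = Graph (H u)
    P = G ⊚ H
    module P = Graph P

  -- Inner steps at the start are dropped. The first step out of the fibre of `a` goes to the fibre
  -- of a neighbour of `b`, where it can be replaced by a step from `(b , w)`, or to the fibre of
  -- `b` itself.
  twin-walk : ∀ {a b} → TrueTwins G a b → ∀ {k v w p} →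
              proj₁ p ≢ a → proj₁ p ≢ b →
              Walk P k (a , v) p → ∃[ l ] l ≤ k × Walk P l (b , w) p
  twin-walk twins p≢a p≢b []            = contradiction refl p≢a
  twin-walk twins p≢a p≢b (inner _ ∷ W) =
    let l , l≤k , W′ = twin-walk twins p≢a p≢b W in l , ℕ.m≤n⇒m≤1+n l≤k , W′
  twin-walk twins p≢a p≢b (outer e ∷ W) with to (twins _) (inj₂ e)
  ... | inj₂ e′   = _ , ℕ.≤-refl , outer e′ ∷ W
  -- The rest of the walk starts in the fibre of `b`; the case of `b` as its own twin moves its
  -- start to `w`.
  ... | inj₁ refl =
    let l , l≤k , W′ = twin-walk (trueTwins-refl G) p≢b p≢b W in
    l , ℕ.m≤n⇒m≤1+n l≤k , W′

  -- The case where `a` and `b` coincide says that a vertex outside a fibre is equidistant from all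
  -- vertices of that fibre.
  twin-dist : ∀ {a b} → TrueTwins G a b → ∀ {p v w} → proj₁ p ≢ a → proj₁ p ≢ b →
              dist P p (a , v) ≡ dist P p (b , w)
  twin-dist twins p≢a p≢b = ≤∞.antisym
    (dist-≤ P (twin-walk (trueTwins-sym G twins) p≢b p≢a))
    (dist-≤ P (twin-walk twins p≢a p≢b))

  -- Any two vertices of the fibre over `u` are joined by a walk of length 2 through `(u′ , t)`.
  fibre-truncated : ∀ {u u′} → u G.~ u′ → H.V u′ →
                    Truncated (H u) (λ v w → dist P (u , v) (u , w))
  fibre-truncated {u} u~u′ t = record
    { self = dist-self P
    ; near = dist-adjacent P ∘ inner
    ; far  = λ v≢w v≁w → dist-unique P [ 2 ]
        ( outer {w = t} u~u′ ∷ (outer (G.~-sym u~u′) ∷ [])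
        , nonadjacent⇒2≤ P (λ { refl → v≢w refl })
            λ { (outer e) → G.~-irrefl e ; (inner e) → v≁w e })
    }

  -- As `u` lies in the closed neighbourhood of `u′`, the vertex `z` is a neighbour of `u`, which
  -- gives distance 1 to `(u , v)`. Distance 1 to `(u′ , w)` would put `z` into the closed
  -- neighbourhood of `u′`. The position `t` in the fibre is arbitrary.
  separates⇒distinguishes : ∀ {u u′ z t v w} → u G.~ u′ → Separates G u u′ z →
                            Distinguishes P (dist P) (z , t) (u , v) (u′ , w)
  separates⇒distinguishes u~u′ (inj₁ refl , z∉) _ = z∉ (inj₂ (G.~-sym u~u′))
  separates⇒distinguishes u~u′ (inj₂ u~z , z∉) eq
    with dist≡1⇒adjacent P (trans (sym eq) (dist-adjacent P (outer (G.~-sym u~z))))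
  ... | outer z~u′ = z∉ (inj₂ (G.~-sym z~u′))
  ... | inner _    = z∉ (inj₁ refl)

  distinguished-in-fibre : ∀ {u v w p} →
                           Distinguishes P (dist P) p (u , v) (u , w) → proj₁ p ≡ u
  distinguished-in-fibre {u} {p = p} d≢ = decidable-stable (proj₁ p G.≟ u) λ p≢u →
    d≢ (twin-dist (trueTwins-refl G) p≢u p≢u)

  section-injective : (s : ∀ u → H.V u) → Injective _≡_ _≡_ λ u → (u , s u)
  section-injective s = cong proj₁

  -- Local metric generators of lexicographic products

  module _ (nonEmpty : ∀ u → NonEmpty (H u)) where

    generator-meets : ∀ {S} → LocalMetricGenerator P S → ∀ u → ∃[ v ] (u , v) P.∈ᵥ S
    generator-meets gen u
      with v , w , v~w ← nonEmpty u
      with p , p∈S , d≢ ← gen (u , v) (u , w) (inner v~w)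
      with refl ← distinguished-in-fibre d≢
      = _ , p∈S

    order≤generator : ∀ {S} → LocalMetricGenerator P S → G.order ≤ ∣ S ∣
    order≤generator gen = ≤-card P G.enum _
      (section-injective (proj₁ ∘ generator-meets gen))
      (proj₂ ∘ generator-meets gen)

    module _ (neighbour : ∀ u → ∃[ u′ ] u G.~ u′) where

      truncated : ∀ u → Truncated (H u) (λ v w → dist P (u , v) (u , w))
      truncated u = fibre-truncated (proj₂ (neighbour u)) (proj₁ (nonEmpty _))

      -- Necessity: generators with at most one vertex per fibre

      module SmallGenerator {S : P.VertexSet} (gen : LocalMetricGenerator P S)
                            (S≤n : ∣ S ∣ ≤ G.order) where
        s : ∀ u → H.V u
        s u = proj₁ (generator-meets gen u)

        -- The chosen vertices already number `G.order`, so they exhaust `S`.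
        only-section : ∀ {u t} → (u , t) P.∈ᵥ S → t ≡ s u
        only-section t∈S
          with _ , refl ← injection-onto P G.enum _ (section-injective s)
                            (proj₂ ∘ generator-meets gen) S≤n t∈S
          = refl

        -- An inner edge is distinguished from within its own fibre, where `s u` is the only vertex
        -- of `S`.
        s-splits : ∀ u → Splits (H u) (s u)
        s-splits u v w v~w
          with (c , t) , t∈S , d≢ ← gen (u , v) (u , w) (inner v~w)
          with refl ← distinguished-in-fibre d≢
          with refl ← only-section t∈S
          = distinguishes⇒exactlyOne (H u) (truncated u) v~w d≢

        -- For distinct twins, choose neighbours `v` of `s x` and `w` of `s y`. The edge between
        -- `(x , v)` and `(y , w)` is then undistinguished: the vertices of `S` over `x` and `y` are
        -- at distance 1 from both ends, and all others cannot tell twins apart.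
        twins⇒≡ : ∀ {x y} → TrueTwins G x y → x ≡ y
        twins⇒≡ {x} {y} twins = decidable-stable (x G.≟ y) twins-distinct⇒⊥
          where
          twins-distinct⇒⊥ : ¬ x ≢ y
          twins-distinct⇒⊥ x≢y
            with x~y ← trueTwins-adjacent G twins x≢y
            with v , v~s ← splits⇒neighbour (H x) (nonEmpty x) (s-splits x)
            with w , w~s ← splits⇒neighbour (H y) (nonEmpty y) (s-splits y)
            with (c , t) , t∈S , d≢ ← gen (x , v) (y , w) (outer x~y)
            with refl ← only-section t∈S
            with c G.≟ x | c G.≟ y
          ... | yes refl | _        = d≢ (trans
            (dist-adjacent P (inner (H.~-sym x v~s))) (sym (dist-adjacent P (outer x~y))))
          ... | no _     | yes refl = d≢ (trans
            (dist-adjacent P (outer (G.~-sym x~y)))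
            (sym (dist-adjacent P (inner (H.~-sym y w~s)))))
          ... | no c≢x   | no c≢y   = d≢ (twin-dist twins c≢x c≢y)

      -- Sufficiency: a generator made of splitting vertices

      module SplittingSection (s : ∀ u → H.V u) (split : ∀ u → Splits (H u) (s u)) where

        OnSection : Pred P.V 0ℓ
        OnSection (u , v) = v ≡ s u

        onSection? : Pred.Decidable OnSection
        onSection? (u , v) = H._≟_ u v (s u)

        ∈S⇔onSection : ∀ {p} → p P.∈ᵥ subset P onSection? ⇔ OnSection p
        ∈S⇔onSection = ∈-subset P onSection?

        S : P.VertexSet
        S = subset P onSection?

        s∈S : ∀ u → (u , s u) P.∈ᵥ S
        s∈S u = from ∈S⇔onSection refl

        ∣S∣≤order : ∣ S ∣ ≤ G.order
        ∣S∣≤order = card-≤ P G.enum proj₁ proj₁-injective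
          where
          proj₁-injective : ∀ {p q} → p P.∈ᵥ S → q P.∈ᵥ S → proj₁ p ≡ proj₁ q → p ≡ q
          proj₁-injective p∈S q∈S refl
            with refl ← to ∈S⇔onSection p∈S
               | refl ← to ∈S⇔onSection q∈S
            = refl

        -- Inner edges are split within their fibre. The ends of an outer edge lie over adjacent
        -- vertices, which by hypothesis are not twins; some `z` lies in exactly one of their closed
        -- neighbourhoods, and the vertex of `S` over `z` distinguishes the edge.
        generator : (∀ {x y} → TrueTwins G x y → x ≡ y) → LocalMetricGenerator P S
        generator _ _ _ (inner {u} v~w) = _ , s∈S u ,
          exactlyOne⇒distinguishes (H u) (truncated u) (split u _ _ v~w)
        generator twins⇒≡ (u , v) (u′ , w) (outer u~u′)
          with separates? G u u′ | separates? G u′ u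
        ... | yes (z , sep) | _ = _ , s∈S z , separates⇒distinguishes u~u′ sep
        ... | no _ | yes (z , sep) =
          _ , s∈S z , separates⇒distinguishes (G.~-sym u~u′) sep ∘ sym
        ... | no ∄z | no ∄z′ = contradiction
          (twins⇒≡ (unseparated⇒trueTwins G ∄z ∄z′)) (~⇒≢ G u~u′)

theorem3 : (G : Graph) → Connected G → 2 ≤ Graph.order G →
    (H : Graph.V G → Graph) → (∀ u → NonEmpty (H u)) →
    (dimₗ (G ⊚ H) ≡ Graph.order G)
    ⇔
    (AtMostOne𝒢PerTwinClass G H ×
    (∀ u → Bipartite (H u) × UniqueNonTrivialComponentOfRadius≤ (H u) 2))
theorem3 G connected 2≤n H nonEmpty = mk⇔ only-if if
  where
  neighbour : ∀ u → ∃[ u′ ] Graph._~_ G u u′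
  neighbour = connected⇒neighbour G connected 2≤n

  basis : ∃ (MinimumSize (LocalMetricGenerator (G ⊚ H)))
  basis = localMetricBasis (G ⊚ H)

  only-if : dimₗ (G ⊚ H) ≡ Graph.order G → _
  only-if dim≡n =
    (λ _ _ _ u≈x u≈y _ _ →
      twins⇒≡ (trueTwins-trans G (trueTwins-sym G u≈x) u≈y)) ,
    (λ u → splits⇒bipartite (H u) (s-splits u) ,
           splits⇒uniqueComponent (H u) (s-splits u) (nonEmpty u))
    where
    open SmallGenerator G H nonEmpty neighbour
      (proj₁ (proj₂ basis)) (ℕ.≤-reflexive dim≡n)

  if : AtMostOne𝒢PerTwinClass G H ×
       (∀ u → Bipartite (H u) × UniqueNonTrivialComponentOfRadius≤ (H u) 2) →
       dimₗ (G ⊚ H) ≡ Graph.order G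
  -- Minimality of the basis against the section gives the upper bound; the lower bound counts
  -- fibres.
  if (atMostOne , structure) = ℕ.≤-antisym
    (ℕ.≤-trans (proj₂ (proj₂ basis) S (generator twins⇒≡)) ∣S∣≤order)
    (order≤generator G H nonEmpty (proj₁ (proj₂ basis)))
    where
    centre : ∀ u → ∃ (Splits (H u))
    centre u = let bipartite , component = structure u in
      centre⇒splits (H u) bipartite component

    open SplittingSection G H nonEmpty neighbour (proj₁ ∘ centre) (proj₂ ∘ centre)

    in-𝒢 : ∀ u → 𝒢 (H u)
    in-𝒢 u = splits⇒𝒢 (H u) (nonEmpty u) (proj₂ (centre u))

    -- Every `H u` is in `𝒢`, so the condition on twin classes leaves one vertex in each class.
    twins⇒≡ : ∀ {x y} → TrueTwins G x y → x ≡ y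
    twins⇒≡ twins = atMostOne _ _ _ (trueTwins-refl G) twins (in-𝒢 _) (in-𝒢 _)
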